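{- Let $n\ge 1$. The map $\phi:\mathcal D_{2n+1,n+1}\to DD_{2n+2}$ defined, for $a_1a_2\cdots a_{2n}(2n+1)\in\mathcal D_{2n+1,n+1}$ in one-line notation, by $$\phi(a_1a_2\dots a_{2n}(2n+1))=a_1',\,1,\,a_3',\,a_2',\,a_5',\,a_4',\,\dots,\,a_{2n-1}',\,a_{2n-2}',\,2n+2,\,a_{2n}',$$ where $a_j'=a_j+1$, is a bijection.
   Context: $\mathcal D_{2n+1,n+1}$ (the D-permutations) is the set of $\sigma\in\mathfrak S_{2n+1}$ with $\sigma(i)\le i$ for every even $i$ and $\sigma(i)\ge i$ for every odd $i$; necessarily $\sigma(2n+1)=2n+1$. $DD_{2n+2}$ (the Dumont derangements) is the set of $\sigma\in\mathfrak S_{2n+2}$ with $\sigma(2i)<2i$ and $\sigma(2i-1)>2i-1$ for all $1\le i\le n+1$. In the displayed word, the entry in position $2i-1$ is $a_{2i-1}'$ for $1\le i\le n$ and $2n+2$ for $i=n+1$; the entry in position $2$ is $1$, and the entry in position $2i$ is $a_{2i-2}'$ for $2\le i\le n+1$. -}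

module Defs where

open import Data.Fin using (Fin; toℕ)
open import Data.Fin.Permutation using (Permutation′; _⟨$⟩ʳ_)
open import Data.Nat using (ℕ; zero; suc; _+_; _*_; _≤_; _<_)
open import Data.Nat.Divisibility using (_∣_)
open import Data.Product using (Σ; _×_; proj₁)
open import Data.Vec using (Vec; []; _∷_; tabulate)
open import Function using (_∘_)
open import Level using (0ℓ)
open import Relation.Binary.Bundles using (Setoid)
open import Relation.Binary.PropositionalEquality using (_≡_; refl; _→-setoid_)
open import Relation.Nullary using (¬_)
import Relation.Binary.Construct.On as On

-- Positions and letters of a permutation of {1, …, m} are elements of Fin m;
-- the parity and order conditions below concern their 1-based values.
⌞_⌟ : ∀ {m} → Fin m → ℕ
⌞ i ⌟ = suc (toℕ i)

IsDPermutation : ∀ {m} → Permutation′ m → Set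
IsDPermutation σ = ∀ i →
  (2 ∣ ⌞ i ⌟ → ⌞ σ ⟨$⟩ʳ i ⌟ ≤ ⌞ i ⌟) × (¬ 2 ∣ ⌞ i ⌟ → ⌞ i ⌟ ≤ ⌞ σ ⟨$⟩ʳ i ⌟)

IsDumontDerangement : ∀ {m} → Permutation′ m → Set
IsDumontDerangement σ = ∀ i →
  (2 ∣ ⌞ i ⌟ → ⌞ σ ⟨$⟩ʳ i ⌟ < ⌞ i ⌟) × (¬ 2 ∣ ⌞ i ⌟ → ⌞ i ⌟ < ⌞ σ ⟨$⟩ʳ i ⌟)

-- Elements are equal when their permutations agree pointwise; the inverse
-- map and the membership proof play no role.
permutationsWith : ∀ {m} → (Permutation′ m → Set) → Setoid 0ℓ 0ℓ
permutationsWith {m} P =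
  On.setoid {B = Σ (Permutation′ m) P} (Fin m →-setoid Fin m) (_⟨$⟩ʳ_ ∘ proj₁)

𝓓 : ℕ → Setoid 0ℓ 0ℓ
𝓓 n = permutationsWith {suc (n * 2)} IsDPermutation

𝓓𝓓 : ℕ → Setoid 0ℓ 0ℓ
𝓓𝓓 n = permutationsWith {2 + n * 2} IsDumontDerangement

oneLine : ∀ {m} → Permutation′ m → Vec ℕ m
oneLine σ = tabulate λ i → ⌞ σ ⟨$⟩ʳ i ⌟

-- Reads off two letters a₂ᵢ₋₁, a₂ᵢ at a time. Here `even` is the entry due at
-- the next even position, namely 1 at first and a₂ᵢ₋₂ + 1 afterwards; `top`
-- goes to the last odd position, and the last letter of the input is not used.
φ-fill : ∀ k → (top even : ℕ) → Vec ℕ (suc (k * 2)) → Vec ℕ (2 + k * 2)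
φ-fill zero    top even (_ ∷ [])    = top ∷ even ∷ []
φ-fill (suc k) top even (a ∷ b ∷ w) = suc a ∷ even ∷ φ-fill k top (suc b) w

φ-word : ∀ n → Vec ℕ (suc (n * 2)) → Vec ℕ (2 + n * 2)
φ-word n = φ-fill n (2 + n * 2) 1

_ : ∀ {a₁ a₂ a₃ a₄ a₅ a₆} →
    φ-word 3 (a₁ ∷ a₂ ∷ a₃ ∷ a₄ ∷ a₅ ∷ a₆ ∷ 7 ∷ []) ≡
    suc a₁ ∷ 1 ∷ suc a₃ ∷ suc a₂ ∷ suc a₅ ∷ suc a₄ ∷ 8 ∷ suc a₆ ∷ []
_ = refl

{-# OPTIONS --safe #-}
-- Write ρ for the extension of σ to 0, 1, …, 2n+1 with ρ(0) = 0, and π for the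
-- involution exchanging 2i and 2i+1 for 0 ≤ i ≤ n. With positions counted from 0,
-- φ(σ) lists the values of ρ ∘ π, each raised by one. The D-condition on σ at j
-- is the Dumont condition on ρ ∘ π at π(j), so the inverse of φ composes with π
-- and then removes the fixed point 0, fixed because a Dumont derangement sends
-- position 2 to 1.
module Submission where

open import Defs
open import Data.Fin using (Fin; zero; suc; toℕ; fromℕ)
open import Data.Fin.Patterns using (0F)
open import Data.Fin.Permutation
  using (Permutation′; _⟨$⟩ʳ_; _≈_; _∘ₚ_; id; swap; lift₀; lift₀-cong; lift₀-remove; remove)
open import Data.Fin.Properties using (suc-injective; toℕ-injective; toℕ-fromℕ; toℕ≤pred[n])
open import Data.Nat using (ℕ; zero; suc; _+_; _*_; _≤_; _<_; z≤n; s≤s; s≤s⁻¹)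
open import Data.Nat.Divisibility using (_∣_; ∣1⇒≡1; ∣m∣n⇒∣m+n; ∣m+n∣m⇒∣n; ∣-refl; n∣m*n; _∣0)
open import Data.Nat.Properties using (+-comm; ≤-antisym; n≤0⇒n≡0)
open import Data.Product using (Σ; _×_; _,_; proj₁; proj₂)
open import Data.Vec using (_∷_; tabulate)
open import Function using (_∘_)
open import Function.Bundles using (Bijection; _⇔_; mk⇔; Equivalence)
open import Relation.Binary.PropositionalEquality using (_≡_; refl; sym; trans; cong; subst)
open import Relation.Nullary using (¬_; contradiction)

2∣n⇒2∤1+n : ∀ {n} → 2 ∣ n → ¬ 2 ∣ suc n
2∣n⇒2∤1+n {n} 2∣n 2∣1+n with ∣1⇒≡1 (∣m+n∣m⇒∣n (subst (2 ∣_) (+-comm 1 n) 2∣1+n) 2∣n)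
... | ()

2∣n⇒2∣2+n : ∀ {n} → 2 ∣ n → 2 ∣ 2 + n
2∣n⇒2∣2+n = ∣m∣n⇒∣m+n ∣-refl

-- The graph of π on natural numbers. Matching on it yields both the parity of a position and the
-- side on which its partner lies.
data Partners : ℕ → ℕ → Set where
  up   : ∀ {a} → 2 ∣ a → Partners a (suc a)
  down : ∀ {a} → 2 ∣ a → Partners (suc a) a

partners-sym : ∀ {a b} → Partners a b → Partners b a
partners-sym (up 2∣a)   = down 2∣a
partners-sym (down 2∣a) = up 2∣a

partners-2+ : ∀ {a b} → Partners a b → Partners (2 + a) (2 + b)
partners-2+ (up 2∣a)   = up (2∣n⇒2∣2+n 2∣a)
partners-2+ (down 2∣a) = down (2∣n⇒2∣2+n 2∣a)

WeakAt : ℕ → ℕ → Set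
WeakAt b r = (2 ∣ b → r ≤ b) × (¬ 2 ∣ b → b ≤ r)

StrictAt : ℕ → ℕ → Set
StrictAt a r = (2 ∣ a → r < a) × (¬ 2 ∣ a → a < r)

-- `suc a` is `b` for odd `b` and `b + 2` for even `b`. Parity is thus preserved, and raising the
-- value turns `b ≤ r` into `b < suc r` and `r ≤ b` into `suc r < b + 2`.
weak⇔strict : ∀ {a b} r → Partners a b → WeakAt b r ⇔ StrictAt (suc a) (suc r)
weak⇔strict r (up 2∣a) = mk⇔
  (λ w → (λ 2∣1+a → contradiction 2∣1+a (2∣n⇒2∤1+n 2∣a)) , λ 2∤1+a → s≤s (proj₂ w 2∤1+a))
  (λ s → (λ 2∣1+a → contradiction 2∣1+a (2∣n⇒2∤1+n 2∣a)) , λ 2∤1+a → s≤s⁻¹ (proj₂ s 2∤1+a))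
weak⇔strict r (down 2∣a) = mk⇔
  (λ w → (λ _ → s≤s (s≤s (proj₁ w 2∣a))) , contradiction (2∣n⇒2∣2+n 2∣a))
  (λ s → (λ _ → s≤s⁻¹ (s≤s⁻¹ (proj₁ s (2∣n⇒2∣2+n 2∣a)))) , contradiction 2∣a)

swapPairs : ∀ k → Permutation′ (k * 2)
swapPairs zero    = id
swapPairs (suc k) = swap (swapPairs k)

swapPairs-involutive : ∀ k → swapPairs k ∘ₚ swapPairs k ≈ id
swapPairs-involutive (suc k) zero          = refl
swapPairs-involutive (suc k) (suc zero)    = refl
swapPairs-involutive (suc k) (suc (suc i)) = cong (λ j → suc (suc j)) (swapPairs-involutive k i)

swapPairs-partners : ∀ k i → Partners (toℕ i) (toℕ (swapPairs k ⟨$⟩ʳ i))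
swapPairs-partners (suc k) zero          = up (2 ∣0)
swapPairs-partners (suc k) (suc zero)    = down (2 ∣0)
swapPairs-partners (suc k) (suc (suc i)) = partners-2+ (swapPairs-partners k i)

swapPairs-cancel : ∀ k {ρ τ : Permutation′ (k * 2)} →
  swapPairs k ∘ₚ ρ ≈ swapPairs k ∘ₚ τ → ρ ≈ τ
swapPairs-cancel k {ρ} {τ} eq j =
  -- `∘ₚ` applies its left factor first, so evaluating both sides at the partner of `j` leads back
  -- to `j`.
  trans (sym (cong (ρ ⟨$⟩ʳ_) (swapPairs-involutive k j)))
    (trans (eq (swapPairs k ⟨$⟩ʳ j)) (cong (τ ⟨$⟩ʳ_) (swapPairs-involutive k j)))

-- For lift₀ σ this is the D-condition on σ: zero-based positions of lift₀ σ are
-- one-based positions of σ.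
WeaklyAlternating : ∀ {m} → Permutation′ m → Set
WeaklyAlternating ρ = ∀ j → WeakAt (toℕ j) (toℕ (ρ ⟨$⟩ʳ j))

lift₀-weaklyAlternating : ∀ {m} (σ : Permutation′ m) →
  IsDPermutation σ → WeaklyAlternating (lift₀ σ)
lift₀-weaklyAlternating σ d zero    = (λ _ → z≤n) , λ _ → z≤n
lift₀-weaklyAlternating σ d (suc i) = d i

weaklyAlternating-resp-≈ : ∀ {m} {ρ τ : Permutation′ m} →
  ρ ≈ τ → WeaklyAlternating τ → WeaklyAlternating ρ
weaklyAlternating-resp-≈ ρ≈τ w j = subst (WeakAt (toℕ j) ∘ toℕ) (sym (ρ≈τ j)) (w j)

weaklyAlternating⇒dumont : ∀ k {ρ : Permutation′ (k * 2)} →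
  WeaklyAlternating ρ → IsDumontDerangement (swapPairs k ∘ₚ ρ)
weaklyAlternating⇒dumont k w i =
  Equivalence.to (weak⇔strict _ (swapPairs-partners k i)) (w (swapPairs k ⟨$⟩ʳ i))

dumont⇒weaklyAlternating : ∀ k {τ : Permutation′ (k * 2)} →
  IsDumontDerangement τ → WeaklyAlternating (swapPairs k ∘ₚ τ)
dumont⇒weaklyAlternating k d j =
  Equivalence.from (weak⇔strict _ (partners-sym (swapPairs-partners k j))) (d (swapPairs k ⟨$⟩ʳ j))

weaklyAlternating⇒fixes-0 : ∀ {m} (ρ : Permutation′ (suc m)) →
  WeaklyAlternating ρ → ρ ⟨$⟩ʳ 0F ≡ 0F
weaklyAlternating⇒fixes-0 ρ w = toℕ-injective (n≤0⇒n≡0 (proj₁ (w 0F) (2 ∣0)))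

-- Position 2n+1 is odd, so its letter is at least 2n+1, which is already the largest. Hence the
-- entry 2n+2 of the displayed word is the raised last letter.
dPermutation-last : ∀ n (σ : Permutation′ (suc (n * 2))) → IsDPermutation σ →
  toℕ (σ ⟨$⟩ʳ fromℕ (n * 2)) ≡ n * 2
dPermutation-last n σ d = ≤-antisym (toℕ≤pred[n] (σ ⟨$⟩ʳ last))
  (subst (_≤ toℕ (σ ⟨$⟩ʳ last)) (toℕ-fromℕ (n * 2)) (s≤s⁻¹ (proj₂ (d last) odd)))
  where
  last = fromℕ (n * 2)

  odd : ¬ 2 ∣ ⌞ last ⌟
  odd = subst (λ a → ¬ 2 ∣ suc a) (sym (toℕ-fromℕ (n * 2))) (2∣n⇒2∤1+n (n∣m*n n))

-- With `g` the values of ρ, both seeds of `φ-fill` are raised values of `g`, which makes the claim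
-- inductive: after two positions `top` is still the raised last value, and the carried `suc b` is
-- the raised value at the new position 0.
φ-fill-tabulate : ∀ k (g : Fin (2 + k * 2) → ℕ) →
  φ-fill k (suc (g (fromℕ (suc (k * 2))))) (suc (g 0F)) (tabulate (g ∘ suc)) ≡
  tabulate (suc ∘ g ∘ (swapPairs (suc k) ⟨$⟩ʳ_))
φ-fill-tabulate zero    g = refl
φ-fill-tabulate (suc k) g =
  cong (λ w → suc (g (suc 0F)) ∷ suc (g 0F) ∷ w) (φ-fill-tabulate k λ i → g (suc (suc i)))

φ-permutation : ∀ n → Permutation′ (suc (n * 2)) → Permutation′ (2 + n * 2)
φ-permutation n σ = swapPairs (suc n) ∘ₚ lift₀ σ

oneLine-φ : ∀ n (σ : Permutation′ (suc (n * 2))) → IsDPermutation σ →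
  oneLine (φ-permutation n σ) ≡ φ-word n (oneLine σ)
oneLine-φ n σ d = sym (trans
  -- The seed 1 is already the raised value of `lift₀ σ` at 0; only 2n+2 has to be rewritten as a
  -- raised value.
  (cong (λ t → φ-fill n (2 + t) 1 (oneLine σ)) (sym (dPermutation-last n σ d)))
  (φ-fill-tabulate n (toℕ ∘ (lift₀ σ ⟨$⟩ʳ_))))

φ-bijection : ∀ n → Bijection (𝓓 n) (𝓓𝓓 n)
φ-bijection n = record
  { to        = λ (σ , d) →
      φ-permutation n σ , weaklyAlternating⇒dumont (suc n) {lift₀ σ} (lift₀-weaklyAlternating σ d)
  ; cong      = λ {(σ , _)} {(τ , _)} → φ-cong {σ} {τ}
  ; bijective =
      (λ {(σ , _)} {(τ , _)} eq i →
        -- Past the common fixed point 0, `lift₀ σ` sends `suc i` to the successor of the value of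
        -- `σ` at `i`.
        suc-injective (swapPairs-cancel (suc n) {lift₀ σ} {lift₀ τ} eq (suc i)))
    , surjective
  }
  where
  φ-cong : ∀ {σ τ} → σ ≈ τ → φ-permutation n σ ≈ φ-permutation n τ
  φ-cong {σ} {τ} σ≈τ i = lift₀-cong σ τ σ≈τ (swapPairs (suc n) ⟨$⟩ʳ i)

  surjective : ∀ ((τ , _) : Σ (Permutation′ (2 + n * 2)) IsDumontDerangement) →
    Σ (Σ (Permutation′ (suc (n * 2))) IsDPermutation) λ (σ , _) →
      ∀ {(σ′ , _) : Σ (Permutation′ (suc (n * 2))) IsDPermutation} →
        σ′ ≈ σ → φ-permutation n σ′ ≈ τ
  -- The condition on `lift₀ σ` is inherited from `ρ`; restricted to positions `suc i`, it is the
  -- D-condition on `σ`.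
  surjective (τ , d) = (σ , weaklyAlternating-resp-≈ {ρ = lift₀ σ} {ρ} lift-σ w ∘ suc) ,
    λ {(σ′ , _)} σ′≈σ i → trans (φ-cong {σ′} {σ} σ′≈σ i)
      (trans (lift-σ (swapPairs (suc n) ⟨$⟩ʳ i)) (cong (τ ⟨$⟩ʳ_) (swapPairs-involutive (suc n) i)))
    where
    ρ = swapPairs (suc n) ∘ₚ τ
    w = dumont⇒weaklyAlternating (suc n) {τ} d
    σ = remove 0F ρ

    lift-σ : lift₀ σ ≈ ρ
    lift-σ = lift₀-remove ρ (weaklyAlternating⇒fixes-0 ρ w)

theorem6p2 : ∀ (n : ℕ) → 1 ≤ n →
    Σ (Bijection (𝓓 n) (𝓓𝓓 n)) λ φ →
    ∀ σ → oneLine (proj₁ (Bijection.to φ σ)) ≡ φ-word n (oneLine (proj₁ σ))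
theorem6p2 n _ = φ-bijection n , λ (σ , d) → oneLine-φ n σ d
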